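{- Let $(S,K,I)$ be a split graph and let $P=v_1\ldots v_n$, with $n\geq 2$, be an induced path in the factor graph $\Phi(S)$. Then $\max\{d_i: i\in[n]\}\in\{d_1,d_2,d_{n-1},d_n\}$. Moreover, if $\max\{d_i:i\in[n]\}=d_1$, then: (1) for each $i\geq 1$: $d_i\geq d_j$ and $N_i\supseteq N_j$ for all $j$ with $i+2\leq j\leq n$; (2) for each $i\geq 1$: $N_i\supseteq\bigcup_{j=i+2}^n N_j$; in particular $\bigcup_{i=1}^n N_i=N_1\cup N_2$; (3) $d_{2k}\geq d_{2k+2}$ and $d_{2k-1}\geq d_{2k+1}$ for all $k\geq 1$ (whenever the indices are at most $n$); (4) $\min\{d_i: i\in[n]\}\in\{d_{n-1},d_n\}$.
   Context: A split graph $(S,K,I)$ is a graph $S$ together with a fixed partition $V(S)=K\dot\cup I$, where $K$ is a clique and $I$ is an independent set. For a vertex $v_i$ of $S$, $N_i$ denotes its open neighborhood in $S$ and $d_i=|N_i|$ its degree in $S$; for $u,v$ write $\eta_{uv}=|N_u\cap N_v|$. The factor graph $\Phi(S)$ is the loopless multigraph with vertex set $I$ in which, for distinct $u,v\in I$, there is one edge joining $u$ and $v$ for each 2-switch of $S$ acting on $u$ and $v$ (a 2-switch replaces edges $ab,cd$ with $ac,bd$ when $ab,cd\in E(S)$ and $ac,bd\notin E(S)$); equivalently, the multiplicity of the edge $uv$ is $\sigma_{uv}=(d_u-\eta_{uv})(d_v-\eta_{uv})$, and $u,v$ are adjacent iff $\sigma_{uv}>0$. An induced path $v_1\ldots v_n$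 in $\Phi(S)$ consists of distinct vertices with consecutive ones adjacent and no other pair adjacent (multiplicities ignored for adjacency). -}

module Defs where

open import Data.Bool.Base using (Bool; true; false)
open import Data.Bool.Properties using () renaming (_≟_ to _≟ᵇ_)
open import Data.Fin.Base using (Fin; zero; toℕ; _<_)
open import Data.Fin.Properties using (_≟_; _<?_)
open import Data.Fin.Subset using (Subset; _∈_; _∪_; _∩_; ⊤; ⊥; ∣_∣)
open import Data.List.Base using (List; length; filter; allFin; cartesianProduct; tabulate)
open import Data.List.Extrema.Nat using (max; min)
open import Data.List.Properties using (filter-≐; filter-none)
open import Data.List.Relation.Unary.All using (universal)
open import Data.Nat.Base using (ℕ; suc) renaming (_<_ to _<ℕ_)
open import Data.Product.Base using (Σ; _×_; _,_)
open import Data.Sum.Base using (_⊎_)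
import Data.Vec.Base as Vec
open import Function.Definitions using (Injective)
open import Relation.Binary.PropositionalEquality using (_≡_; _≢_; refl; sym; cong)
open import Relation.Nullary using (¬_; Dec; _×-dec_; _⊎-dec_; ¬?)

record Graph (m : ℕ) : Set where
  field
    adj    : Fin m → Fin m → Bool
    symm   : ∀ u v → adj u v ≡ adj v u
    irrefl : ∀ v → adj v v ≡ false

  Edge : Fin m → Fin m → Set
  Edge u v = adj u v ≡ true

  Edge? : ∀ u v → Dec (Edge u v)
  Edge? u v = adj u v ≟ᵇ true

  N : Fin m → Subset m
  N v = Vec.tabulate (adj v)

  deg : Fin m → ℕ
  deg v = ∣ N v ∣

record SplitGraph (m : ℕ) : Set where
  field
    graph       : Graph m
    K I         : Subset m
  open Graph graph public
  field
    cover       : K ∪ I ≡ ⊤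
    disjoint    : K ∩ I ≡ ⊥
    clique      : ∀ {u v} → u ∈ K → v ∈ K → u ≢ v → Edge u v
    independent : ∀ {u v} → u ∈ I → v ∈ I → ¬ Edge u v

Quad : ℕ → Set
Quad m = Fin m × Fin m × Fin m × Fin m

quads : ∀ m → List (Quad m)
quads m = cartesianProduct (allFin m) (cartesianProduct (allFin m) (cartesianProduct (allFin m) (allFin m)))

_∈Q_ : ∀ {m} → Fin m → Quad m → Set
u ∈Q (a , b , c , d) = u ≡ a ⊎ u ≡ b ⊎ u ≡ c ⊎ u ≡ d

_∈Q?_ : ∀ {m} (u : Fin m) (q : Quad m) → Dec (u ∈Q q)
u ∈Q? (a , b , c , d) = (u ≟ a) ⊎-dec (u ≟ b) ⊎-dec (u ≟ c) ⊎-dec (u ≟ d)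

module _ {m : ℕ} (G : Graph m) where
  open Graph G

  -- (a , b , c , d) stands for replacing the edges ab, cd by ac, bd.
  IsTwoSwitch : Quad m → Set
  IsTwoSwitch (a , b , c , d) =
    (a ≢ b × a ≢ c × a ≢ d × b ≢ c × b ≢ d × c ≢ d) ×
    Edge a b × Edge c d × ¬ Edge a c × ¬ Edge b d

  IsTwoSwitch? : ∀ q → Dec (IsTwoSwitch q)
  IsTwoSwitch? (a , b , c , d) =
    (¬? (a ≟ b) ×-dec ¬? (a ≟ c) ×-dec ¬? (a ≟ d) ×-dec
     ¬? (b ≟ c) ×-dec ¬? (b ≟ d) ×-dec ¬? (c ≟ d)) ×-dec
    Edge? a b ×-dec Edge? c d ×-dec ¬? (Edge? a c) ×-dec ¬? (Edge? b d)

  -- The same replacement {ab, cd} ↦ {ac, bd} is described by exactly the four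
  -- quadruples (a,b,c,d), (b,a,d,c), (c,d,a,b), (d,c,b,a); these have distinct
  -- first entries, so exactly one of them has its least vertex first.
  Normal : Quad m → Set
  Normal (a , b , c , d) = a < b × a < c × a < d

  Normal? : ∀ q → Dec (Normal q)
  Normal? (a , b , c , d) = (a <? b) ×-dec (a <? c) ×-dec (a <? d)

  -- Each 2-switch of G is listed exactly once.
  twoSwitches : List (Quad m)
  twoSwitches = filter (λ q → Normal? q ×-dec IsTwoSwitch? q) (quads m)

  ActsOn : Fin m → Fin m → Quad m → Set
  ActsOn u v q = u ≢ v × u ∈Q q × v ∈Q q

  ActsOn? : ∀ u v q → Dec (ActsOn u v q)
  ActsOn? u v q = ¬? (u ≟ v) ×-dec (u ∈Q? q) ×-dec (v ∈Q? q)

  switchCount : Fin m → Fin m → ℕ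
  switchCount u v = length (filter (ActsOn? u v) twoSwitches)

  switchCount-sym : ∀ u v → switchCount u v ≡ switchCount v u
  switchCount-sym u v = cong length
    (filter-≐ (ActsOn? u v) (ActsOn? v u) (swap , swap) twoSwitches)
    where
    swap : ∀ {x y q} → ActsOn x y q → ActsOn y x q
    swap (x≢y , x∈ , y∈) = (λ e → x≢y (sym e)) , y∈ , x∈

  switchCount-loopless : ∀ u → switchCount u u ≡ 0
  switchCount-loopless u = cong length
    (filter-none (ActsOn? u u) (universal (λ { _ (u≢u , _) → u≢u refl }) twoSwitches))

record Multigraph (V : Set) : Set where
  field
    mult     : V → V → ℕ
    symm     : ∀ u v → mult u v ≡ mult v u
    loopless : ∀ v → mult v v ≡ 0

  Adjacent : V → V → Set
  Adjacent u v = 0 <ℕ mult u v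

Φ : ∀ {m} (S : SplitGraph m) → Multigraph (Σ (Fin m) (_∈ SplitGraph.I S))
Φ S = record
  { mult     = λ (u , _) (v , _) → switchCount graph u v
  ; symm     = λ (u , _) (v , _) → switchCount-sym graph u v
  ; loopless = λ (v , _) → switchCount-loopless graph v
  }
  where open SplitGraph S using (graph)

record InducedPath {V : Set} (G : Multigraph V) (n : ℕ) : Set where
  open Multigraph G
  field
    vertex      : Fin n → V
    distinct    : Injective _≡_ _≡_ vertex
    consecutive : ∀ i j → toℕ j ≡ suc (toℕ i) → Adjacent (vertex i) (vertex j)
    induced     : ∀ i j → Adjacent (vertex i) (vertex j) →
                  toℕ j ≡ suc (toℕ i) ⊎ toℕ i ≡ suc (toℕ j)

-- The 1-based index of a position, so that vertex i is v_{pos i}.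
pos : ∀ {n} → Fin n → ℕ
pos i = suc (toℕ i)

-- The first argument of the library's max and min is an extra element of the
-- list; taking it from the family itself leaves the extremum unchanged.
maximum minimum : ∀ {n} → (Fin (suc n) → ℕ) → ℕ
maximum f = max (f zero) (tabulate f)
minimum f = min (f zero) (tabulate f)

{-# OPTIONS --safe #-}

-- For u, v ∈ I a 2-switch acting on both consists of a neighbour of u outside N_v and a
-- neighbour of v outside N_u, so u and v are adjacent in Φ(S) exactly when N_u and N_v are
-- ⊆-incomparable.  An induced path is thus a sequence of sets in which consecutive members
-- are incomparable and all others comparable.  If N_i contains N_j and N_{i+1} ⊆ N_j, then
-- N_{i+1} ⊆ N_i, which is impossible; this pushes the inclusions N_1 ⊇ N_j down the path.
-- The same argument run from both sides of an interior maximum yields a contradiction.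
module Submission where

open import Defs
open import Data.Empty using (⊥-elim)
open import Data.Nat.Base using (ℕ; _+_; _*_; _∸_; _≤_; _<_; _≥_; z≤n; s≤s; s≤s⁻¹) renaming (suc to sucℕ)
open import Data.Nat.Properties using (_≤?_; ≤-reflexive; ≤-trans; ≤-antisym; ≤∧≢⇒<; <⇒≱; n≤1+n; +-comm; +-suc)
open import Data.Fin.Base using (Fin; zero; suc; toℕ; fromℕ; fromℕ<; inject₁)
open import Data.Fin.Induction using (<-weakInduction)
open import Data.Fin.Properties using (any?; toℕ-injective; toℕ-fromℕ; toℕ-fromℕ<; toℕ-inject₁)
open import Data.Fin.Subset using (Subset; _⊆_; _∪_; ⋃; ∣_∣) renaming (_∈_ to _∈ₛ_)
open import Data.Fin.Subset.Properties using (_∈?_; ∈⊤; ∉⊥; ⊆-antisym; ⊆-trans; p⊆q⇒∣p∣≤∣q∣; p⊂q⇒∣p∣<∣q∣; p⊆p∪q; q⊆p∪q; x∈p∪q⁻)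
open import Data.List.Base using (List; length; _∷_; []; map; filter; allFin; tabulate)
open import Data.List.Extrema.Nat using (argmin; argmin-sel; argmax-sel; f[argmin]≤f[⊤]; f[argmin]≤f[xs]; min≤xs; xs≤max)
open import Data.List.Membership.Propositional using (_∈_)
open import Data.List.Membership.Propositional.Properties using (∈-filter⁺; ∈-filter⁻; ∈-length; ∈-map⁺; ∈-tabulate⁻; ∈-allFin; ∈-cartesianProduct⁺)
import Data.List.Relation.Unary.All as All
open import Data.List.Relation.Unary.All using (All; []; _∷_)
open import Data.List.Relation.Unary.All.Properties using (all-filter; map⁺; tabulate⁺; tabulate⁻)
open import Data.List.Relation.Unary.Any using (here; there)
open import Data.Product.Base using (∃; ∃-syntax; _×_; _,_; proj₁; proj₂)
open import Data.Sum.Base using (_⊎_; inj₁; inj₂)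
open import Data.Vec.Properties using ([]=⇒lookup; lookup⇒[]=; lookup∘tabulate)
open import Function.Base using (id; _∘_)
open import Relation.Binary.PropositionalEquality using (_≡_; _≢_; refl; sym; trans; cong; subst)
open import Relation.Nullary using (¬_; Dec; yes; no; ¬?; _×-dec_)

-- Unions and cardinalities of finite subsets.

⋃-least : ∀ {m} {q : Subset m} {ps} → All (_⊆ q) ps → ⋃ ps ⊆ q
⋃-least []           x∈ = ⊥-elim (∉⊥ x∈)
⋃-least (p⊆q ∷ ps⊆q) x∈ with x∈p∪q⁻ _ _ x∈
... | inj₁ x∈p  = p⊆q x∈p
... | inj₂ x∈ps = ⋃-least ps⊆q x∈ps

⊆-⋃ : ∀ {m} {p : Subset m} {ps} → p ∈ ps → p ⊆ ⋃ ps
⊆-⋃ (here refl)  x∈p = p⊆p∪q _ x∈p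
⊆-⋃ (there p∈ps) x∈p = q⊆p∪q _ _ (⊆-⋃ p∈ps x∈p)

-- An element of `q` outside `p` would make the inclusion strict, hence `∣ p ∣ < ∣ q ∣`. This is how
-- a comparison of degrees becomes an inclusion of neighbourhoods.
p⊆q∧∣q∣≤∣p∣⇒q⊆p : ∀ {m} {p q : Subset m} → p ⊆ q → ∣ q ∣ ≤ ∣ p ∣ → q ⊆ p
p⊆q∧∣q∣≤∣p∣⇒q⊆p {p = p} p⊆q ∣q∣≤∣p∣ {x} x∈q with x ∈? p
... | yes x∈p = x∈p
... | no  x∉p = ⊥-elim (<⇒≱ (p⊂q⇒∣p∣<∣q∣ (p⊆q , x , x∈q , x∉p)) ∣q∣≤∣p∣)

-- Extrema of finite families, and the last indices of a path.

≤-maximum : ∀ {n} (f : Fin (sucℕ n) → ℕ) i → f i ≤ maximum f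
≤-maximum f = tabulate⁻ (xs≤max (f zero) (tabulate f))

minimum-≤ : ∀ {n} (f : Fin (sucℕ n) → ℕ) i → minimum f ≤ f i
minimum-≤ f = tabulate⁻ (min≤xs (f zero) (tabulate f))

selected-value : ∀ {n x} {f : Fin (sucℕ n) → ℕ} → x ≡ f zero ⊎ x ∈ tabulate f → ∃[ i ] x ≡ f i
selected-value (inj₁ eq) = zero , eq
selected-value (inj₂ ∈f) = ∈-tabulate⁻ ∈f

maximum-elim : ∀ {n} (f : Fin (sucℕ n) → ℕ) (P : ℕ → Set) →
  (∀ i → (∀ j → f j ≤ f i) → P (f i)) → P (maximum f)
maximum-elim f P step = conclude (selected-value (argmax-sel id (f zero) (tabulate f))) (≤-maximum f)
  where
  -- With the extremal value generalised to a variable `x`, matching on `refl` can replace it by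
  -- `f i`.
  conclude : ∀ {x} → ∃[ i ] x ≡ f i → (∀ j → f j ≤ x) → P x
  conclude (i , refl) = step i

minimum-elim : ∀ {n} (f : Fin (sucℕ n) → ℕ) (P : ℕ → Set) →
  (∀ i → (∀ j → f i ≤ f j) → P (f i)) → P (minimum f)
minimum-elim f P step = conclude (selected-value (argmin-sel id (f zero) (tabulate f))) (minimum-≤ f)
  where
  conclude : ∀ {x} → ∃[ i ] x ≡ f i → (∀ j → x ≤ f j) → P x
  conclude (i , refl) = step i

-- The third alternative has the form required by `comparable`, with the last index as the later
-- one; it also says that at least two indices follow `i`.
last-two-or-before : ∀ {r} (i : Fin (2 + r)) →
  i ≡ inject₁ (fromℕ r) ⊎ i ≡ fromℕ (1 + r) ⊎ pos i + 2 ≤ pos (fromℕ (1 + r))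
last-two-or-before {0}      zero       = inj₁ refl
last-two-or-before {0}      (suc zero) = inj₂ (inj₁ refl)
last-two-or-before {sucℕ r} zero       = inj₂ (inj₂ (s≤s (s≤s (s≤s z≤n))))
last-two-or-before {sucℕ r} (suc i) with last-two-or-before i
... | inj₁ eq        = inj₁ (cong suc eq)
... | inj₂ (inj₁ eq) = inj₂ (inj₁ (cong suc eq))
... | inj₂ (inj₂ le) = inj₂ (inj₂ (s≤s le))

-- 2-switches

module _ {m : ℕ} (G : Graph m) where
  open Graph G

  -- The symmetries of the replacement {ab, cd} ↦ {ac, bd} act transitively on its vertices.
  startingAt : ∀ {q u} → IsTwoSwitch G q → u ∈Q q →
    ∃[ b ] ∃[ c ] ∃[ d ] IsTwoSwitch G (u , b , c , d) ×
      (∀ {v} → v ∈Q q → v ∈Q (u , b , c , d)) × (∀ {v} → v ∈Q (u , b , c , d) → v ∈Q q)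
  startingAt sw (inj₁ refl) = _ , _ , _ , sw , id , id
  startingAt ((a≢b , a≢c , a≢d , b≢c , b≢d , c≢d) , ab , cd , ¬ac , ¬bd) (inj₂ (inj₁ refl)) =
    _ , _ , _ ,
    ((a≢b ∘ sym , b≢d , b≢c , a≢d , a≢c , c≢d ∘ sym) ,
      trans (symm _ _) ab , trans (symm _ _) cd , ¬bd , ¬ac) ,
    swap , swap
    where
    swap : ∀ {v a b c d} → v ∈Q (a , b , c , d) → v ∈Q (b , a , d , c)
    swap (inj₁ e)               = inj₂ (inj₁ e)
    swap (inj₂ (inj₁ e))        = inj₁ e
    swap (inj₂ (inj₂ (inj₁ e))) = inj₂ (inj₂ (inj₂ e))
    swap (inj₂ (inj₂ (inj₂ e))) = inj₂ (inj₂ (inj₁ e))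
  startingAt ((a≢b , a≢c , a≢d , b≢c , b≢d , c≢d) , ab , cd , ¬ac , ¬bd) (inj₂ (inj₂ (inj₁ refl))) =
    _ , _ , _ ,
    ((c≢d , a≢c ∘ sym , b≢c ∘ sym , a≢d ∘ sym , b≢d ∘ sym , a≢b) ,
      cd , ab , ¬ac ∘ trans (symm _ _) , ¬bd ∘ trans (symm _ _)) ,
    swap , swap
    where
    swap : ∀ {v a b c d} → v ∈Q (a , b , c , d) → v ∈Q (c , d , a , b)
    swap (inj₁ e)               = inj₂ (inj₂ (inj₁ e))
    swap (inj₂ (inj₁ e))        = inj₂ (inj₂ (inj₂ e))
    swap (inj₂ (inj₂ (inj₁ e))) = inj₁ e
    swap (inj₂ (inj₂ (inj₂ e))) = inj₂ (inj₁ e)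
  startingAt ((a≢b , a≢c , a≢d , b≢c , b≢d , c≢d) , ab , cd , ¬ac , ¬bd) (inj₂ (inj₂ (inj₂ refl))) =
    _ , _ , _ ,
    ((c≢d ∘ sym , b≢d ∘ sym , a≢d ∘ sym , b≢c ∘ sym , a≢c ∘ sym , a≢b ∘ sym) ,
      trans (symm _ _) cd , trans (symm _ _) ab , ¬bd ∘ trans (symm _ _) , ¬ac ∘ trans (symm _ _)) ,
    swap , swap
    where
    swap : ∀ {v a b c d} → v ∈Q (a , b , c , d) → v ∈Q (d , c , b , a)
    swap (inj₁ e)               = inj₂ (inj₂ (inj₂ e))
    swap (inj₂ (inj₁ e))        = inj₂ (inj₂ (inj₁ e))
    swap (inj₂ (inj₂ (inj₁ e))) = inj₂ (inj₁ e)
    swap (inj₂ (inj₂ (inj₂ e))) = inj₁ e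

  -- abstract: the with-abstractions below would otherwise unfold argmin, which is intractable.
  abstract
    leastVertex : (q : Quad m) → ∃[ u ] u ∈Q q × (∀ {v} → v ∈Q q → toℕ u ≤ toℕ v)
    leastVertex (a , b , c , d) =
      argmin toℕ a rest , occurs (argmin-sel toℕ a rest) ,
      least (f[argmin]≤f[⊤] {f = toℕ} a rest) (f[argmin]≤f[xs] {f = toℕ} a rest)
      where
      rest : List (Fin m)
      rest = b ∷ c ∷ d ∷ []

      occurs : ∀ {u} → u ≡ a ⊎ u ∈ rest → u ∈Q (a , b , c , d)
      occurs (inj₁ e)                        = inj₁ e
      occurs (inj₂ (here e))                 = inj₂ (inj₁ e)
      occurs (inj₂ (there (here e)))         = inj₂ (inj₂ (inj₁ e))
      occurs (inj₂ (there (there (here e)))) = inj₂ (inj₂ (inj₂ e))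

      least : ∀ {k} → k ≤ toℕ a → All (λ v → k ≤ toℕ v) rest → ∀ {v} → v ∈Q (a , b , c , d) → k ≤ toℕ v
      least k≤a _                       (inj₁ refl)               = k≤a
      least _   (k≤b ∷ _)               (inj₂ (inj₁ refl))        = k≤b
      least _   (_ ∷ k≤c ∷ _)           (inj₂ (inj₂ (inj₁ refl))) = k≤c
      least _   (_ ∷ _ ∷ k≤d ∷ _)       (inj₂ (inj₂ (inj₂ refl))) = k≤d

  -- `twoSwitches` keeps only the description whose least vertex comes first, so the switch is
  -- re-read from that vertex. The vertex set is carried along so that `ActsOn` survives.
  normalise : ∀ {q} → IsTwoSwitch G q →
    ∃[ q′ ] Normal G q′ × IsTwoSwitch G q′ × (∀ {v} → v ∈Q q → v ∈Q q′)
  normalise {q} sw with leastVertex q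
  ... | u , u∈q , least with startingAt sw u∈q
  ... | b , c , d , sw′@((u≢b , u≢c , u≢d , _) , _) , to , from =
    (u , b , c , d) ,
    (strict u≢b (inj₂ (inj₁ refl)) ,
     strict u≢c (inj₂ (inj₂ (inj₁ refl))) ,
     strict u≢d (inj₂ (inj₂ (inj₂ refl)))) ,
    sw′ , to
    where
    strict : ∀ {v} → u ≢ v → v ∈Q (u , b , c , d) → toℕ u < toℕ v
    strict u≢v v∈ = ≤∧≢⇒< (least (from v∈)) (u≢v ∘ toℕ-injective)

  switchCount⁺ : ∀ {u v q} → IsTwoSwitch G q → ActsOn G u v q → 0 < switchCount G u v
  switchCount⁺ sw (u≢v , u∈q , v∈q) with normalise sw
  ... | (_ , _ , _ , _) , normal , sw′ , to =
    ∈-length (∈-filter⁺ (ActsOn? G _ _)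
      (∈-filter⁺ (λ q → Normal? G q ×-dec IsTwoSwitch? G q) listed (normal , sw′))
      (u≢v , to u∈q , to v∈q))
    where
    listed : ∀ {a b c d} → (a , b , c , d) ∈ quads m
    listed = ∈-cartesianProduct⁺ (∈-allFin _)
      (∈-cartesianProduct⁺ (∈-allFin _) (∈-cartesianProduct⁺ (∈-allFin _) (∈-allFin _)))

  switchCount⁻ : ∀ {u v} → 0 < switchCount G u v → ∃[ q ] IsTwoSwitch G q × ActsOn G u v q
  switchCount⁻ {u} {v} pos with member pos
    where
    member : ∀ {A : Set} {xs : List A} → 0 < length xs → ∃ (_∈ xs)
    member {xs = x ∷ _} _ = x , here refl
  ... | q , q∈ with ∈-filter⁻ (ActsOn? G u v) {xs = twoSwitches G} q∈
  ... | q∈switches , acts =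
    q , proj₂ (proj₂ (∈-filter⁻ (λ q → Normal? G q ×-dec IsTwoSwitch? G q) {xs = quads m} q∈switches)) , acts

-- Adjacency in the factor graph

module _ {m : ℕ} (S : SplitGraph m) where
  open SplitGraph S

  edge⇒∈N : ∀ {u x} → Edge u x → x ∈ₛ N u
  edge⇒∈N {u} {x} e = lookup⇒[]= x (N u) (trans (lookup∘tabulate (adj u) x) e)

  ∈N⇒edge : ∀ {u x} → x ∈ₛ N u → Edge u x
  ∈N⇒edge {u} {x} x∈ = trans (sym (lookup∘tabulate (adj u) x)) ([]=⇒lookup x∈)

  ¬loop : ∀ {v} → ¬ Edge v v
  ¬loop {v} e with trans (sym (irrefl v)) e
  ... | ()

  neighbour∈K : ∀ {u x} → u ∈ₛ I → Edge u x → x ∈ₛ K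
  neighbour∈K {x = x} u∈I ux with x∈p∪q⁻ K I (subst (x ∈ₛ_) (sym cover) ∈⊤)
  ... | inj₁ x∈K = x∈K
  ... | inj₂ x∈I = ⊥-elim (independent u∈I x∈I ux)

  PrivateNeighbour : Fin m → Fin m → Fin m → Set
  PrivateNeighbour u v x = Edge u x × ¬ Edge v x

  -- Read the switch as `(u , b , c , d)`. Independence of `I` excludes `v ≡ b`. If `v ≡ c`, then
  -- `b` and `d` are neighbours of `u` and `v`, so both lie in the clique `K` and `bd` is an edge,
  -- which the switch forbids. Hence `v ≡ d`, and `b`, `c` are the private neighbours.
  adjacent⇒private : ∀ {u v} → u ∈ₛ I → v ∈ₛ I → 0 < switchCount graph u v →
    ∃ (PrivateNeighbour u v) × ∃ (PrivateNeighbour v u)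
  adjacent⇒private u∈I v∈I uv with switchCount⁻ graph uv
  ... | (_ , _ , _ , _) , sw , u≢v , u∈q , v∈q with startingAt graph sw u∈q
  ... | b , c , d , ((_ , _ , _ , _ , b≢d , _) , ub , cd , ¬uc , ¬bd) , to , _ with to v∈q
  ... | inj₁ refl               = ⊥-elim (u≢v refl)
  ... | inj₂ (inj₁ refl)        = ⊥-elim (independent u∈I v∈I ub)
  ... | inj₂ (inj₂ (inj₁ refl)) =
    ⊥-elim (¬bd (clique (neighbour∈K u∈I ub) (neighbour∈K v∈I cd) b≢d))
  ... | inj₂ (inj₂ (inj₂ refl)) =
    (b , ub , ¬bd ∘ trans (symm _ _)) , (c , trans (symm _ _) cd , ¬uc)

  -- The switch replaces `ub`, `cv` by `uc`, `bv`. Its four vertices are distinct because there are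
  -- no loops, `I` is independent, and `b`, `c` are private.
  private⇒adjacent : ∀ {u v} → u ∈ₛ I → v ∈ₛ I →
    ∃ (PrivateNeighbour u v) → ∃ (PrivateNeighbour v u) → 0 < switchCount graph u v
  private⇒adjacent {u} {v} u∈I v∈I (b , ub , ¬vb) (c , vc , ¬uc) =
    switchCount⁺ graph {q = u , b , c , v}
      ((u≢b , u≢c , u≢v , b≢c , b≢v , c≢v) , ub , trans (symm _ _) vc , ¬uc , ¬vb ∘ trans (symm _ _))
      (u≢v , inj₁ refl , inj₂ (inj₂ (inj₂ refl)))
    where
    u≢b : u ≢ b
    u≢b refl = ¬loop ub
    u≢c : u ≢ c
    u≢c refl = independent v∈I u∈I vc
    u≢v : u ≢ v
    u≢v refl = ¬vb ub
    b≢c : b ≢ c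
    b≢c refl = ¬uc ub
    b≢v : b ≢ v
    b≢v refl = independent u∈I v∈I ub
    c≢v : c ≢ v
    c≢v refl = ¬loop vc

  private? : ∀ u v → Dec (∃ (PrivateNeighbour u v))
  private? u v = any? λ x → Edge? u x ×-dec ¬? (Edge? v x)

  ¬private⇒N⊆N : ∀ {u v} → ¬ ∃ (PrivateNeighbour u v) → N u ⊆ N v
  ¬private⇒N⊆N {v = v} none {x} x∈Nu with Edge? v x
  ... | yes vx = edge⇒∈N vx
  ... | no ¬vx = ⊥-elim (none (x , ∈N⇒edge x∈Nu , ¬vx))

  private⇒N⊈N : ∀ {u v} → ∃ (PrivateNeighbour u v) → ¬ N u ⊆ N v
  private⇒N⊈N (x , ux , ¬vx) Nu⊆Nv = ¬vx (∈N⇒edge (Nu⊆Nv (edge⇒∈N ux)))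

  adjacent⇒incomparable : ∀ {u v} → u ∈ₛ I → v ∈ₛ I → 0 < switchCount graph u v →
    ¬ N u ⊆ N v × ¬ N v ⊆ N u
  adjacent⇒incomparable u∈I v∈I uv =
    private⇒N⊈N (proj₁ privates) , private⇒N⊈N (proj₂ privates)
    where privates = adjacent⇒private u∈I v∈I uv

  -- Private neighbours on both sides would give a switch. Deciding both finite searches tells
  -- constructively which inclusion to return.
  ¬adjacent⇒comparable : ∀ {u v} → u ∈ₛ I → v ∈ₛ I → ¬ 0 < switchCount graph u v →
    N u ⊆ N v ⊎ N v ⊆ N u
  ¬adjacent⇒comparable {u} {v} u∈I v∈I ¬uv with private? u v | private? v u
  ... | no none | _       = inj₁ (¬private⇒N⊆N none)
  ... | yes _   | no none = inj₂ (¬private⇒N⊆N none)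
  ... | yes pu  | yes pv  = ⊥-elim (¬uv (private⇒adjacent u∈I v∈I pu pv))

-- Sequences of sets in which exactly the consecutive members are incomparable

module _ {m r : ℕ} (N : Fin (2 + r) → Subset m)
  (incomparable : ∀ {i j} → toℕ j ≡ sucℕ (toℕ i) → ¬ N i ⊆ N j × ¬ N j ⊆ N i)
  (comparable   : ∀ {i j} → pos i + 2 ≤ pos j → N i ⊆ N j ⊎ N j ⊆ N i)
  where

  private
    d : Fin (2 + r) → ℕ
    d i = ∣ N i ∣

  -- The two sets are comparable; if the inclusion goes the wrong way, the sizes force equality.
  largest-contains-later : ∀ {i j} → d j ≤ d i → pos i + 2 ≤ pos j → N j ⊆ N i
  largest-contains-later dj≤di i+2≤j with comparable i+2≤j
  ... | inj₁ Ni⊆Nj = p⊆q∧∣q∣≤∣p∣⇒q⊆p Ni⊆Nj dj≤di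
  ... | inj₂ Nj⊆Ni = Nj⊆Ni

  largest-contains-earlier : ∀ {i j} → d j ≤ d i → pos j + 2 ≤ pos i → N j ⊆ N i
  largest-contains-earlier dj≤di j+2≤i with comparable j+2≤i
  ... | inj₁ Nj⊆Ni = Nj⊆Ni
  ... | inj₂ Ni⊆Nj = p⊆q∧∣q∣≤∣p∣⇒q⊆p Ni⊆Nj dj≤di

  -- By maximality `N c` contains `N a` and `N f`. So `N b ⊆ N f` would give `N b ⊆ N c`, and
  -- `N e ⊆ N a` would give `N e ⊆ N c`; both are impossible, leaving `N f ⊆ N b` and `N a ⊆ N e`.
  ¬interior-largest : ∀ {a b c e f} →
    toℕ b ≡ sucℕ (toℕ a) → toℕ c ≡ sucℕ (toℕ b) → toℕ e ≡ sucℕ (toℕ c) → toℕ f ≡ sucℕ (toℕ e) →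
    ¬ (∀ j → d j ≤ d c)
  ¬interior-largest {a} {b} {c} {e} {f} ab bc ce ef largest = contradictory
    where
    skip₂ : ∀ {i j k : Fin (2 + r)} → toℕ j ≡ sucℕ (toℕ i) → toℕ k ≡ sucℕ (toℕ j) → pos i + 2 ≤ pos k
    skip₂ {i} ij jk = s≤s (≤-reflexive (trans (+-comm (toℕ i) 2) (sym (trans jk (cong sucℕ ij)))))

    skip₃ : ∀ {i j k l : Fin (2 + r)} → toℕ j ≡ sucℕ (toℕ i) → toℕ k ≡ sucℕ (toℕ j) → toℕ l ≡ sucℕ (toℕ k) →
            pos i + 2 ≤ pos l
    skip₃ ij jk kl = ≤-trans (skip₂ ij jk) (s≤s (≤-trans (n≤1+n _) (≤-reflexive (sym kl))))

    Nf⊆Nb : N f ⊆ N b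
    Nf⊆Nb with comparable (skip₃ bc ce ef)
    ... | inj₂ Nf⊆Nb = Nf⊆Nb
    ... | inj₁ Nb⊆Nf = ⊥-elim (proj₁ (incomparable bc)
      (⊆-trans Nb⊆Nf (largest-contains-later (largest f) (skip₂ ce ef))))

    Na⊆Ne : N a ⊆ N e
    Na⊆Ne with comparable (skip₃ ab bc ce)
    ... | inj₁ Na⊆Ne = Na⊆Ne
    ... | inj₂ Ne⊆Na = ⊥-elim (proj₂ (incomparable ce)
      (⊆-trans Ne⊆Na (largest-contains-earlier (largest a) (skip₂ ab bc))))

    contradictory : _
    -- The two neighbours of `c` on the path are themselves comparable: one inclusion yields
    -- `N f ⊆ N e`, the other `N a ⊆ N b`.
    contradictory with comparable (skip₂ bc ce)
    ... | inj₁ Nb⊆Ne = proj₂ (incomparable ef) (⊆-trans Nf⊆Nb Nb⊆Ne)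
    ... | inj₂ Ne⊆Nb = proj₁ (incomparable ab) (⊆-trans Na⊆Ne Ne⊆Nb)

  largest-near-ends : ∀ {i} → (∀ j → d j ≤ d i) →
    d i ∈ (d zero ∷ d (suc zero) ∷ d (inject₁ (fromℕ r)) ∷ d (fromℕ (1 + r)) ∷ [])
  largest-near-ends {zero}        _ = here refl
  largest-near-ends {suc zero}    _ = there (here refl)
  largest-near-ends {suc (suc k)} largest with last-two-or-before (suc (suc k))
  ... | inj₁ eq            = there (there (here (cong d eq)))
  ... | inj₂ (inj₁ eq)     = there (there (there (here (cong d eq))))
  ... | inj₂ (inj₂ before) =
    -- The five consecutive indices have values `toℕ k` up to `toℕ k + 4`, with the supposed maximum
    -- in the middle; `before` guarantees that the last two exist.
    ⊥-elim (¬interior-largest {inject₁ (inject₁ k)} {suc (inject₁ k)} {suc (suc k)} {fromℕ< k+3<n} {fromℕ< k+4<n}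
      (cong sucℕ (sym (toℕ-inject₁ (inject₁ k))))
      (cong (2 +_) (sym (toℕ-inject₁ k)))
      (toℕ-fromℕ< k+3<n)
      (trans (toℕ-fromℕ< k+4<n) (cong sucℕ (sym (toℕ-fromℕ< k+3<n))))
      largest)
    where
    k+4<n : 4 + toℕ k < 2 + r
    k+4<n = subst (_≤ 2 + r) (+-comm (3 + toℕ k) 2)
      (subst (pos (suc (suc k)) + 2 ≤_) (cong sucℕ (toℕ-fromℕ (1 + r))) before)
    k+3<n : 3 + toℕ k < 2 + r
    k+3<n = ≤-trans (n≤1+n _) k+4<n

  module _ (first-largest : ∀ j → d j ≤ d zero) where

    contains-later : ∀ i j → pos i + 2 ≤ pos j → N j ⊆ N i
    contains-later = <-weakInduction (λ i → ∀ j → pos i + 2 ≤ pos j → N j ⊆ N i) base step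
      where
      base : ∀ j → 3 ≤ pos j → N j ⊆ N zero
      base j = largest-contains-later (first-largest j)

      step : ∀ i → (∀ j → pos (inject₁ i) + 2 ≤ pos j → N j ⊆ N (inject₁ i)) →
             ∀ j → pos (suc i) + 2 ≤ pos j → N j ⊆ N (suc i)
      step i ih j i+3≤j with comparable i+3≤j
      ... | inj₂ Nj⊆Ni+1 = Nj⊆Ni+1
      -- Since `j` is at least three past `inject₁ i`, `ih` applies to it and gives an inclusion of
      -- `N (suc i)` in its predecessor `N (inject₁ i)`.
      ... | inj₁ Ni+1⊆Nj = ⊥-elim (proj₂ (incomparable (cong sucℕ (sym (toℕ-inject₁ i))))
        (⊆-trans Ni+1⊆Nj (ih j (subst (λ t → sucℕ t + 2 ≤ pos j) (sym (toℕ-inject₁ i)) (≤-trans (n≤1+n _) i+3≤j)))))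

    later-≤ : ∀ i j → pos i + 2 ≤ pos j → d j ≤ d i
    later-≤ i j i+2≤j = p⊆q⇒∣p∣≤∣q∣ (contains-later i j i+2≤j)

    ⋃-later-⊆ : ∀ i → ⋃ (map N (filter (λ j → pos i + 2 ≤? pos j) (allFin (2 + r)))) ⊆ N i
    ⋃-later-⊆ i = ⋃-least (map⁺ (All.map (λ {j} → contains-later i j)
      (all-filter (λ j → pos i + 2 ≤? pos j) (allFin (2 + r)))))

    ⋃-all : ⋃ (map N (allFin (2 + r))) ≡ N zero ∪ N (suc zero)
    ⋃-all = ⊆-antisym (⋃-least (map⁺ (tabulate⁺ below))) above
      where
      below : ∀ i → N i ⊆ N zero ∪ N (suc zero)
      below zero          = p⊆p∪q _
      below (suc zero)    = q⊆p∪q _ _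
      below (suc (suc i)) = ⊆-trans (contains-later zero (suc (suc i)) (s≤s (s≤s (s≤s z≤n)))) (p⊆p∪q _)

      above : N zero ∪ N (suc zero) ⊆ ⋃ (map N (allFin (2 + r)))
      above x∈ with x∈p∪q⁻ _ _ x∈
      ... | inj₁ x∈N₁ = ⊆-⋃ (∈-map⁺ N (∈-allFin zero)) x∈N₁
      ... | inj₂ x∈N₂ = ⊆-⋃ (∈-map⁺ N (∈-allFin (suc zero))) x∈N₂

    alternate-≤ : ∀ k → k ≥ 1 →
      (∀ i j → pos i ≡ 2 * k → pos j ≡ 2 * k + 2 → d i ≥ d j)
      × (∀ i j → pos i ≡ 2 * k ∸ 1 → pos j ≡ 2 * k + 1 → d i ≥ d j)
    -- For a successor the truncated subtraction is exact: with `m = 2 * sucℕ k ∸ 1`, `2 * sucℕ k`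
    -- is `sucℕ m`, and `+-suc` supplies `m + 2 ≡ sucℕ m + 1`.
    alternate-≤ (sucℕ k) _ =
      (λ i j ei ej → later-≤ i j (≤-reflexive (trans (cong (_+ 2) ei) (sym ej)))) ,
      (λ i j ei ej → later-≤ i j (≤-reflexive (trans (cong (_+ 2) ei) (trans (+-suc _ 1) (sym ej)))))

    smallest-at-end : ∀ {i} → (∀ j → d i ≤ d j) →
      d i ∈ (d (inject₁ (fromℕ r)) ∷ d (fromℕ (1 + r)) ∷ [])
    smallest-at-end {i} smallest with last-two-or-before i
    ... | inj₁ eq            = here (cong d eq)
    ... | inj₂ (inj₁ eq)     = there (here (cong d eq))
    -- Only the value is matched: the last vertex has degree at most `d i` by `later-≤`, and at
    -- least `d i` by minimality.
    ... | inj₂ (inj₂ before) = there (here (≤-antisym (smallest _) (later-≤ i _ before)))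

-- Neighbourhoods along an induced path of the factor graph.

theorem2p4 : ∀ {m : ℕ} (S : SplitGraph m) (r : ℕ) (P : InducedPath (Φ S) (2 + r)) →
  let n = 2 + r
      d : Fin n → ℕ
      d i = SplitGraph.deg S (proj₁ (InducedPath.vertex P i))
      N : Fin n → Subset m
      N i = SplitGraph.N S (proj₁ (InducedPath.vertex P i))
      v₁ : Fin n
      v₁ = zero
      v₂ : Fin n
      v₂ = suc zero
      vₙ₋₁ : Fin n
      vₙ₋₁ = inject₁ (fromℕ r)
      vₙ : Fin n
      vₙ = fromℕ (1 + r)
  in
  (maximum d ∈ (d v₁ ∷ d v₂ ∷ d vₙ₋₁ ∷ d vₙ ∷ []))
  × (maximum d ≡ d v₁ →
      (∀ i j → pos i + 2 ≤ pos j → d i ≥ d j × N j ⊆ N i)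
      × ((∀ i → ⋃ (map N (filter (λ j → pos i + 2 ≤? pos j) (allFin n))) ⊆ N i)
         × ⋃ (map N (allFin n)) ≡ N v₁ ∪ N v₂)
      × (∀ (k : ℕ) → k ≥ 1 →
           (∀ i j → pos i ≡ 2 * k → pos j ≡ 2 * k + 2 → d i ≥ d j)
           × (∀ i j → pos i ≡ 2 * k ∸ 1 → pos j ≡ 2 * k + 1 → d i ≥ d j))
      × (minimum d ∈ (d vₙ₋₁ ∷ d vₙ ∷ [])))
theorem2p4 S r P =
  -- d is syntactically the one in the type; comparing two maxima by unfolding is intractable.
  let d : Fin (2 + r) → ℕ
      d i = SplitGraph.deg S (proj₁ (InducedPath.vertex P i))
  in
  maximum-elim d (_∈ _) (λ _ → largest-near-ends Nᵥ incomparable comparable) , λ max≡d₁ →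
    let first-largest : ∀ j → d j ≤ d zero
        first-largest j = subst (d j ≤_) max≡d₁ (≤-maximum d j)
    in
    (λ i j i+2≤j →
      later-≤ Nᵥ incomparable comparable first-largest i j i+2≤j ,
      contains-later Nᵥ incomparable comparable first-largest i j i+2≤j) ,
    (⋃-later-⊆ Nᵥ incomparable comparable first-largest ,
     ⋃-all Nᵥ incomparable comparable first-largest) ,
    alternate-≤ Nᵥ incomparable comparable first-largest ,
    minimum-elim d (_∈ _) (λ _ → smallest-at-end Nᵥ incomparable comparable first-largest)
  where
  open InducedPath P

  Nᵥ : Fin (2 + r) → Subset _
  Nᵥ i = SplitGraph.N S (proj₁ (vertex i))

  incomparable : ∀ {i j} → toℕ j ≡ sucℕ (toℕ i) → ¬ Nᵥ i ⊆ Nᵥ j × ¬ Nᵥ j ⊆ Nᵥ i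
  incomparable {i} {j} ij =
    adjacent⇒incomparable S (proj₂ (vertex i)) (proj₂ (vertex j)) (consecutive i j ij)

  comparable : ∀ {i j} → pos i + 2 ≤ pos j → Nᵥ i ⊆ Nᵥ j ⊎ Nᵥ j ⊆ Nᵥ i
  comparable {i} {j} i+2≤j =
    -- By `induced`, adjacency would make the positions consecutive in one order or the other; a gap
    -- of two excludes both.
    ¬adjacent⇒comparable S (proj₂ (vertex i)) (proj₂ (vertex j)) (¬consecutive ∘ induced i j)
    where
    2+i≤j : 2 + toℕ i ≤ toℕ j
    2+i≤j = subst (_≤ toℕ j) (+-comm (toℕ i) 2) (s≤s⁻¹ i+2≤j)

    ¬consecutive : ¬ (toℕ j ≡ sucℕ (toℕ i) ⊎ toℕ i ≡ sucℕ (toℕ j))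
    ¬consecutive (inj₁ j≡1+i) = <⇒≱ 2+i≤j (≤-reflexive j≡1+i)
    ¬consecutive (inj₂ i≡1+j) = <⇒≱ (≤-trans (n≤1+n _) 2+i≤j) (≤-trans (n≤1+n _) (≤-reflexive (sym i≡1+j)))
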